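{- Every $\Delta(1,2,2)$-free tournament $T$ with $n$ vertices satisfies $\vec{\alpha}(T)\ge \frac{3n}{7}$.
   Context: Tournaments are finite; $T$ is $S$-free if no induced subtournament of $T$ is isomorphic to $S$. $\Delta(1,2,2)$ is the tournament on $\{x,y_1,y_2,z_1,z_2\}$ in which every edge between $x$ and $\{y_1,y_2\}$ goes from $x$, every edge between $\{y_1,y_2\}$ and $\{z_1,z_2\}$ goes into $\{z_1,z_2\}$, every edge between $\{z_1,z_2\}$ and $x$ goes into $x$, and $y_1y_2$, $z_1z_2$ are edges. $\vec{\alpha}(T)$ denotes the maximum number of vertices of a transitive subtournament of $T$. -}

module Defs where

open import Data.Nat using (ℕ; _*_; _≤_)
open import Data.Fin using (Fin; zero; suc)
open import Data.Bool using (Bool; true; false; not)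
open import Data.Product using (Σ; _×_; ∃-syntax)
open import Relation.Binary.PropositionalEquality using (_≡_; _≢_)
open import Relation.Nullary using (¬_)
open import Function.Definitions using (Injective)

-- A tournament on vertex set Fin n: adj i j ≡ true means the edge i → j.
record Tournament (n : ℕ) : Set where
  field
    adj    : Fin n → Fin n → Bool
    irrefl : ∀ i → adj i i ≡ false
    tourn  : ∀ i j → i ≢ j → adj i j ≡ not (adj j i)
open Tournament public

-- Δ(1,2,2) on Fin 5: 0 = x, 1 = y₁, 2 = y₂, 3 = z₁, 4 = z₂.
-- x → yᵢ, yᵢ → zⱼ, zⱼ → x, y₁ → y₂, z₁ → z₂.
Δ122 : Fin 5 → Fin 5 → Bool
Δ122 zero (suc zero) = true
Δ122 zero (suc (suc zero)) = true
Δ122 (suc zero) (suc (suc zero)) = true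
Δ122 (suc zero) (suc (suc (suc zero))) = true
Δ122 (suc zero) (suc (suc (suc (suc zero)))) = true
Δ122 (suc (suc zero)) (suc (suc (suc zero))) = true
Δ122 (suc (suc zero)) (suc (suc (suc (suc zero)))) = true
Δ122 (suc (suc (suc zero))) zero = true
Δ122 (suc (suc (suc zero))) (suc (suc (suc (suc zero)))) = true
Δ122 (suc (suc (suc (suc zero)))) zero = true
Δ122 _ _ = false

InducedCopy : ∀ {n m} → Tournament n → (Fin m → Fin m → Bool) → Set
InducedCopy {n} {m} T S =
  Σ (Fin m → Fin n) λ f → Injective _≡_ _≡_ f × (∀ a b → adj T (f a) (f b) ≡ S a b)

Δ122-free : ∀ {n} → Tournament n → Set
Δ122-free T = ¬ InducedCopy T Δ122

HasTransitiveSub : ∀ {n} → Tournament n → ℕ → Set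
HasTransitiveSub {n} T k =
  Σ (Fin k → Fin n) λ f → Injective _≡_ _≡_ f ×
    (∀ a b c → adj T (f a) (f b) ≡ true → adj T (f b) (f c) ≡ true →
               adj T (f a) (f c) ≡ true)

{-# OPTIONS --safe #-}
module Submission where

-- Some vertices are declared heavy: a heavy vertex stands for a copy of the 7-vertex Paley
-- tournament, counting 7 towards the number of vertices and 3 towards a transitive set. The
-- weighted inequality is proved by induction on the number of vertices, looking at a vertex r of
-- minimum out-degree d. If w → u are out-neighbours of r, then any two out-neighbours of u that
-- are in-neighbours of r lie on opposite sides of w, since both after w or both before w would
-- give Δ(1,2,2) with apex r or u. So u has at most two of them, and minimality of d leaves room
-- for at most one in-neighbour of u among the out-neighbours of r; hence d ≤ 3.
-- If d = 3, the vertices reachable from r form a Paley tournament, which the rest dominates.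
-- If d = 2, either r lies in a dominated regular 5-vertex tournament, or six vertices around r can
-- be contracted to one heavy vertex. If d ≤ 1, one deletes at most three vertices.

open import Defs
open import Data.Bool using (Bool; true; false; not; _∨_; if_then_else_)
open import Data.Bool.Properties renaming (_≟_ to _≟ᵇ_) using ()
open import Data.Empty using (⊥; ⊥-elim)
open import Data.Fin using (Fin; zero; suc; toℕ)
open import Data.Fin.Patterns using (0F; 1F; 2F; 3F; 4F)
import Data.Fin.Properties as Fin
open import Data.List using (List; []; _∷_; _++_; length; map; filter; lookup; allFin)
open import Data.List.Extrema.Nat using (argmin; argmin-sel; f[argmin]≤f[⊤]; f[argmin]≤f[xs])
open import Data.List.Membership.Propositional using (_∈_; _∉_)
open import Data.List.Membership.Propositional.Properties
  using (∈-∃++; ∈-filter⁺; ∈-filter⁻; ∈-++⁺ˡ; ∈-++⁺ʳ; ∈-++⁻; ∈-lookup)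
import Data.List.Membership.DecPropositional as DecMembership
open import Data.List.Properties using (length-++; length-tabulate; map-++; filter-notAll)
open import Data.List.Relation.Binary.Permutation.Propositional.Properties using (shift; ∈-resp-↭; map⁺)
open import Data.List.Relation.Binary.Subset.Propositional using (_⊆_)
open import Data.List.Relation.Unary.All as All using (All; []; _∷_)
open import Data.List.Relation.Unary.AllPairs using (AllPairs; []; _∷_)
import Data.List.Relation.Unary.AllPairs.Properties as AllPairs
open import Data.List.Relation.Unary.Any as Any using (here; there)
open import Data.List.Relation.Unary.Any.Properties using (¬Any[])
open import Data.List.Relation.Unary.Unique.Propositional using (Unique)
open import Data.List.Relation.Unary.Unique.Propositional.Properties using (filter⁺; allFin⁺)
open import Data.Nat using (ℕ; zero; suc; _+_; _*_; _≤_; _<_; z≤n; s≤s)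
open import Data.Nat.ListAction using (sum)
open import Data.Nat.ListAction.Properties using (sum-++; sum-↭)
open import Data.Nat.Properties
  using (≤-trans; ≤-reflexive; ≤-pred; <-≤-trans; <⇒≱; <-trans; <-irrefl; <-asym; n<1+n; m≤m+n; _≤?_;
    +-comm; +-assoc; +-mono-≤; +-monoʳ-≤; +-cancelˡ-≤; +-cancelʳ-≡; *-monoʳ-≤; *-distribˡ-+;
    module ≤-Reasoning)
open import Data.Product using (_×_; _,_; proj₁; proj₂; ∃-syntax)
open import Data.Sum using (_⊎_; inj₁; inj₂)
open import Function using (_∘_; const)
open import Relation.Binary.Definitions using (DecidableEquality)
open import Relation.Binary.PropositionalEquality using (_≡_; _≢_; refl; sym; trans; cong; cong₂; subst; ≢-sym)
open import Relation.Nullary using (¬_; Dec; yes; no; ¬?; ⌊_⌋)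
open import Relation.Nullary.Decidable using (toWitness; _⊎-dec_)

-- Sums over lists without repetition

sum-map-⊆ : ∀ {A : Set} (f : A → ℕ) {xs ys : List A} → Unique xs → xs ⊆ ys →
  sum (map f xs) ≤ sum (map f ys)
sum-map-⊆ f {[]} _ _ = z≤n
sum-map-⊆ f {x ∷ xs} (x∉xs ∷ xs!) xs⊆ys with ∈-∃++ (xs⊆ys (here refl))
... | ys₁ , ys₂ , refl = begin
  f x + sum (map f xs)             ≤⟨ +-monoʳ-≤ (f x) (sum-map-⊆ f xs! rest) ⟩
  f x + sum (map f (ys₁ ++ ys₂))   ≡⟨ sum-↭ (map⁺ f (shift x ys₁ ys₂)) ⟨
  sum (map f (ys₁ ++ x ∷ ys₂))     ∎
  where
  open ≤-Reasoning
  rest : xs ⊆ ys₁ ++ ys₂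
  -- Distinctness of the entries ensures that the rest of `xs` survives when one occurrence of `x`
  -- is taken out of `ys`.
  rest y∈xs with ∈-resp-↭ (shift x ys₁ ys₂) (xs⊆ys (there y∈xs))
  ... | here refl = ⊥-elim (All.lookup x∉xs y∈xs refl)
  ... | there y∈  = y∈

sum-map-1 : ∀ {A : Set} (xs : List A) → sum (map (const 1) xs) ≡ length xs
sum-map-1 []       = refl
sum-map-1 (_ ∷ xs) = cong suc (sum-map-1 xs)

length-⊆ : ∀ {A : Set} {xs ys : List A} → Unique xs → xs ⊆ ys → length xs ≤ length ys
length-⊆ {xs = xs} {ys} xs! xs⊆ys = begin
  length xs                ≡⟨ sum-map-1 xs ⟨
  sum (map (const 1) xs)   ≤⟨ sum-map-⊆ (const 1) xs! xs⊆ys ⟩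
  sum (map (const 1) ys)   ≡⟨ sum-map-1 ys ⟩
  length ys                ∎
  where open ≤-Reasoning

module _ {A : Set} {u : A} {f g : A → ℕ} (f≈g : ∀ {v} → v ≢ u → f v ≡ g v) where

  sum-map-∉ : ∀ {xs} → u ∉ xs → sum (map f xs) ≡ sum (map g xs)
  sum-map-∉ {[]}     _    = refl
  sum-map-∉ {x ∷ xs} u∉xs =
    cong₂ _+_ (f≈g λ x≡u → u∉xs (here (sym x≡u))) (sum-map-∉ (u∉xs ∘ there))

  -- Subtraction-free form of the change `f u - g u` caused by altering a function at `u` only; `u`
  -- is counted once because the list has no repetition.
  sum-map-∈ : ∀ {xs} → Unique xs → u ∈ xs → sum (map f xs) + g u ≡ sum (map g xs) + f u
  sum-map-∈ {x ∷ xs} (x∉xs ∷ _) (here refl) = begin-equality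
    f x + sum (map f xs) + g x   ≡⟨ cong (λ k → f x + k + g x) (sum-map-∉ λ u∈ → All.lookup x∉xs u∈ refl) ⟩
    f x + sum (map g xs) + g x   ≡⟨ +-comm _ (g x) ⟩
    g x + (f x + sum (map g xs)) ≡⟨ cong (g x +_) (+-comm (f x) _) ⟩
    g x + (sum (map g xs) + f x) ≡⟨ +-assoc (g x) _ _ ⟨
    g x + sum (map g xs) + f x   ∎
    where open ≤-Reasoning
  sum-map-∈ {x ∷ xs} (x∉xs ∷ xs!) (there u∈xs) = begin-equality
    f x + sum (map f xs) + g u   ≡⟨ +-assoc (f x) _ _ ⟩
    f x + (sum (map f xs) + g u) ≡⟨ cong₂ _+_ (f≈g λ x≡u → All.lookup x∉xs u∈xs x≡u) (sum-map-∈ xs! u∈xs) ⟩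
    g x + (sum (map g xs) + f u) ≡⟨ +-assoc (g x) _ _ ⟨
    g x + sum (map g xs) + f u   ∎
    where open ≤-Reasoning

-- Local structure of tournaments without Δ(1,2,2)

module ΔFree
  {V : Set} (_≟_ : DecidableEquality V)
  (_⇾_ : V → V → Set)
  (_⇾?_ : ∀ x y → Dec (x ⇾ y))
  (asym : ∀ {x y} → x ⇾ y → ¬ (y ⇾ x))
  (total : ∀ {x y} → x ≢ y → x ⇾ y ⊎ y ⇾ x)
  (free : ∀ {x y y′ z z′} → y ≢ y′ → z ≢ z′ → x ⇾ y → x ⇾ y′ →
          y ⇾ z → y ⇾ z′ → y′ ⇾ z → y′ ⇾ z′ → z ⇾ x → z′ ⇾ x → ⊥)
  where

  open DecMembership _≟_ using (_∈?_)

  ⇾⇒≢ : ∀ {x y} → x ⇾ y → x ≢ y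
  ⇾⇒≢ x⇾y refl = asym x⇾y x⇾y

  path⇒≢ : ∀ {x y z} → x ⇾ y → y ⇾ z → x ≢ z
  path⇒≢ x⇾y y⇾z refl = asym x⇾y y⇾z

  separated : ∀ {r w u p q} → r ⇾ w → r ⇾ u → w ⇾ u → p ≢ q →
    u ⇾ p → u ⇾ q → p ⇾ r → q ⇾ r → (w ⇾ p × q ⇾ w) ⊎ (w ⇾ q × p ⇾ w)
  separated rw ru wu p≢q up uq pr qr
    with total (≢-sym (path⇒≢ pr rw)) | total (≢-sym (path⇒≢ qr rw))
  -- Apex `r`, with pairs `w`, `u` and `p`, `q`.
  ... | inj₁ wp | inj₁ wq = ⊥-elim (free (⇾⇒≢ wu) p≢q rw ru wp wq up uq pr qr)
  ... | inj₁ wp | inj₂ qw = inj₁ (wp , qw)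
  ... | inj₂ pw | inj₁ wq = inj₂ (wq , pw)
  -- Apex `u`, with pairs `p`, `q` and `r`, `w`.
  ... | inj₂ pw | inj₂ qw = ⊥-elim (free p≢q (⇾⇒≢ rw) up uq pr pw qr qw ru wu)

  -- By pigeonhole two of the three returning vertices lie on the same side of `w`, which
  -- `separated` forbids.
  ¬three-returns : ∀ {r w u p q s} → r ⇾ w → r ⇾ u → w ⇾ u → p ≢ q → p ≢ s → q ≢ s →
    u ⇾ p → u ⇾ q → u ⇾ s → p ⇾ r → q ⇾ r → s ⇾ r → ⊥
  ¬three-returns rw ru wu p≢q p≢s q≢s up uq us pr qr sr
    with separated rw ru wu p≢q up uq pr qr | separated rw ru wu p≢s up us pr sr
       | separated rw ru wu q≢s uq us qr sr
  ... | inj₁ (_ , qw)  | inj₁ _         | inj₁ (wq , _) = asym wq qw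
  ... | inj₁ _         | inj₁ (_ , sw)  | inj₂ (ws , _) = asym ws sw
  ... | inj₁ (wp , _)  | inj₂ (_ , pw)  | _             = asym wp pw
  ... | inj₂ (_ , pw)  | inj₁ (wp , _)  | _             = asym wp pw
  ... | inj₂ _         | inj₂ (ws , _)  | inj₁ (_ , sw) = asym ws sw
  ... | inj₂ (wq , _)  | inj₂ _         | inj₂ (_ , qw) = asym wq qw

  returns≤2 : ∀ {r w u xs} → r ⇾ w → r ⇾ u → w ⇾ u → Unique xs →
    (∀ {x} → x ∈ xs → u ⇾ x × x ⇾ r) → length xs ≤ 2
  returns≤2 {xs = []}         _ _ _ _ _ = z≤n
  returns≤2 {xs = _ ∷ []}     _ _ _ _ _ = s≤s z≤n
  returns≤2 {xs = _ ∷ _ ∷ []} _ _ _ _ _ = s≤s (s≤s z≤n)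
  returns≤2 {xs = p ∷ q ∷ s ∷ _} rw ru wu ((p≢q ∷ p≢s ∷ _) ∷ (q≢s ∷ _) ∷ _) xs⊆ =
    let up , pr = xs⊆ (here refl)
        uq , qr = xs⊆ (there (here refl))
        us , sr = xs⊆ (there (there (here refl)))
    in ⊥-elim (¬three-returns rw ru wu p≢q p≢s q≢s up uq us pr qr sr)

  -- Out-degrees and returning vertices

  module OutNeighbours (L : List V) (L! : Unique L) where

    out : V → List V
    out v = filter (v ⇾?_) L

    deg : V → ℕ
    deg v = length (out v)

    out! : ∀ {v} → Unique (out v)
    out! {v} = filter⁺ (v ⇾?_) L!

    ∈-out⁺ : ∀ {v x} → x ∈ L → v ⇾ x → x ∈ out v
    ∈-out⁺ {v} = ∈-filter⁺ (v ⇾?_)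

    ∈-out⁻ : ∀ {v x} → x ∈ out v → x ∈ L × v ⇾ x
    ∈-out⁻ {v} = ∈-filter⁻ (v ⇾?_)

    returns : V → V → List V
    returns r u = filter (_⇾? r) (out u)

    ∈-returns⁻ : ∀ {r u x} → x ∈ returns r u → x ∈ L × u ⇾ x × x ⇾ r
    ∈-returns⁻ {r} x∈ with x∈out , xr ← ∈-filter⁻ (_⇾? r) x∈ =
      let x∈L , ux = ∈-out⁻ x∈out in x∈L , ux , xr

    returns! : ∀ {r u} → Unique (returns r u)
    returns! {r} = filter⁺ (_⇾? r) out!

    returns-length≤2 : ∀ {r w u} → r ⇾ w → r ⇾ u → w ⇾ u → length (returns r u) ≤ 2
    returns-length≤2 rw ru wu = returns≤2 rw ru wu returns! (proj₂ ∘ ∈-returns⁻)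

    deg≤ : ∀ {r u} (K : List V) → (∀ {x} → x ∈ L → u ⇾ x → x ∈ K ⊎ x ⇾ r) →
      deg u ≤ length K + length (returns r u)
    deg≤ {r} {u} K cover =
      ≤-trans (length-⊆ out! out⊆) (≤-reflexive (length-++ K))
      where
      out⊆ : out u ⊆ K ++ returns r u
      out⊆ x∈out with x∈L , ux ← ∈-out⁻ x∈out with cover x∈L ux
      ... | inj₁ x∈K = ∈-++⁺ˡ x∈K
      ... | inj₂ xr  = ∈-++⁺ʳ K (∈-filter⁺ (_⇾? r) x∈out xr)

    -- The two vertices leading from `u` back to `r` are named by their side of `w`: `p` comes after
    -- `w` and `q` before it. `K` accounts for the other out-neighbours of `u`.
    record Returns (r w u : V) (K : List V) : Set where
      field
        {p q} : V
        p∈L   : p ∈ L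
        q∈L   : q ∈ L
        up    : u ⇾ p
        uq    : u ⇾ q
        pr    : p ⇾ r
        qr    : q ⇾ r
        wp    : w ⇾ p
        qw    : q ⇾ w
        only  : ∀ {x} → x ∈ L → u ⇾ x → x ∈ p ∷ q ∷ K

    -- The degree bound forces at least two returns and `returns-length≤2` allows no more, so there
    -- are exactly two, and `separated` decides which of them is `p`.
    two-returns : ∀ {r w u} (K : List V) → r ⇾ w → r ⇾ u → w ⇾ u →
      (∀ {x} → x ∈ L → u ⇾ x → x ∈ K ⊎ x ⇾ r) →
      length K + 2 ≤ deg u → Returns r w u K
    two-returns {r} {w} {u} K rw ru wu cover d
      with returns r u in eq | returns! {r} {u} | returns-length≤2 rw ru wu
         | +-cancelˡ-≤ (length K) _ _ (≤-trans d (deg≤ {r} K cover))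
    ... | p ∷ q ∷ [] | (p≢q ∷ _) ∷ _ | _ | _ = result
      where
      back : ∀ {x} → x ∈ p ∷ q ∷ [] → x ∈ L × u ⇾ x × x ⇾ r
      back x∈ = ∈-returns⁻ (subst (_ ∈_) (sym eq) x∈)
      only′ : ∀ {x} → x ∈ L → u ⇾ x → x ∈ p ∷ q ∷ K
      only′ x∈L ux with cover x∈L ux
      ... | inj₁ x∈K = there (there x∈K)
      ... | inj₂ xr with subst (_ ∈_) eq (∈-filter⁺ (_⇾? r) (∈-out⁺ x∈L ux) xr)
      ...   | here x≡p         = here x≡p
      ...   | there (here x≡q) = there (here x≡q)
      swap : ∀ {x} → x ∈ p ∷ q ∷ K → x ∈ q ∷ p ∷ K
      swap (here e)         = there (here e)
      swap (there (here e)) = here e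
      swap (there (there e)) = there (there e)
      result : Returns r w u K
      result with p∈ , up , pr ← back (here refl) with q∈ , uq , qr ← back (there (here refl))
        with separated rw ru wu p≢q up uq pr qr
      ... | inj₁ (wp , qw) = record
        { p∈L = p∈ ; q∈L = q∈ ; up = up ; uq = uq ; pr = pr ; qr = qr
        ; wp = wp ; qw = qw ; only = only′ }
      ... | inj₂ (wq , pw) = record
        { p∈L = q∈ ; q∈L = p∈ ; up = uq ; uq = up ; pr = qr ; qr = pr
        ; wp = wq ; qw = pw ; only = λ x∈L ux → swap (only′ x∈L ux) }
    ... | _ ∷ []        | _ | _              | s≤s ()
    ... | _ ∷ _ ∷ _ ∷ _ | _ | s≤s (s≤s ())   | _

    -- The common out-neighbours of `r` and `u`, together with `u`, `w`, `w′`, are distinct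
    -- out-neighbours of `r`, so there are at most `deg r - 3` of them. The other out-neighbours of
    -- `u` return to `r`, and these number at most two, so `u` would have smaller out-degree than
    -- `r`.
    indegree≤1 : ∀ {r u w w′} → (∀ {v} → v ∈ L → deg r ≤ deg v) →
      u ∈ out r → w ∈ out r → w′ ∈ out r → w ≢ w′ → w ⇾ u → w′ ⇾ u → ⊥
    indegree≤1 {r} {u} {w} {w′} minimal u∈ w∈ w′∈ w≢w′ wu w′u = <⇒≱ deg-u<deg-r (minimal u∈L)
      where
      ru  = proj₂ (∈-out⁻ u∈)
      rw  = proj₂ (∈-out⁻ w∈)
      u∈L = proj₁ (∈-out⁻ u∈)
      K : List V
      K = filter (r ⇾?_) (out u)
      K⁻ : ∀ {x} → x ∈ K → (x ∈ L × u ⇾ x) × r ⇾ x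
      K⁻ x∈ with x∈out , rx ← ∈-filter⁻ (r ⇾?_) x∈ = ∈-out⁻ x∈out , rx
      cover : ∀ {x} → x ∈ L → u ⇾ x → x ∈ K ⊎ x ⇾ r
      cover x∈L ux with total (path⇒≢ ru ux)
      ... | inj₁ rx = inj₁ (∈-filter⁺ (r ⇾?_) (∈-out⁺ x∈L ux) rx)
      ... | inj₂ xr = inj₂ xr
      all! : Unique (u ∷ w ∷ w′ ∷ K)
      all! = (≢-sym (⇾⇒≢ wu) ∷ ≢-sym (⇾⇒≢ w′u) ∷ All.tabulate λ x∈ → ⇾⇒≢ (proj₂ (proj₁ (K⁻ x∈))))
           ∷ (w≢w′ ∷ All.tabulate λ x∈ → path⇒≢ wu (proj₂ (proj₁ (K⁻ x∈))))
           ∷ (All.tabulate λ x∈ → path⇒≢ w′u (proj₂ (proj₁ (K⁻ x∈))))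
           ∷ filter⁺ (r ⇾?_) out!
      all⊆ : u ∷ w ∷ w′ ∷ K ⊆ out r
      all⊆ (here refl)                 = u∈
      all⊆ (there (here refl))         = w∈
      all⊆ (there (there (here refl))) = w′∈
      all⊆ (there (there (there x∈)))  = let (x∈L , _) , rx = K⁻ x∈ in ∈-out⁺ x∈L rx
      open ≤-Reasoning
      deg-u<deg-r : deg u < deg r
      deg-u<deg-r = begin-strict
        deg u                           ≤⟨ deg≤ {r} K cover ⟩
        length K + length (returns r u) ≤⟨ +-monoʳ-≤ (length K) (returns-length≤2 rw ru wu) ⟩
        length K + 2                    ≡⟨ +-comm (length K) 2 ⟩
        2 + length K                    <⟨ n<1+n _ ⟩
        3 + length K                    ≤⟨ length-⊆ all! all⊆ ⟩
        deg r                           ∎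

  -- Heavy vertices and weighted transitive sets

  size weight : (V → Bool) → V → ℕ
  size   Q v = if Q v then 7 else 1
  weight Q v = if Q v then 3 else 1

  total-size total-weight : (V → Bool) → List V → ℕ
  total-size   Q = sum ∘ map (size Q)
  total-weight Q = sum ∘ map (weight Q)

  total-size-light : ∀ {Q S} → All (λ v → Q v ≡ false) S → total-size Q S ≡ length S
  total-size-light []                    = refl
  total-size-light (light ∷ ls) rewrite light = cong suc (total-size-light ls)

  length≤total-weight : ∀ Q xs → length xs ≤ total-weight Q xs
  length≤total-weight Q []       = z≤n
  length≤total-weight Q (x ∷ xs) = +-mono-≤ (1≤weight (Q x)) (length≤total-weight Q xs)
    where
    1≤weight : ∀ b → 1 ≤ (if b then 3 else 1)
    1≤weight true  = s≤s z≤n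
    1≤weight false = s≤s z≤n

  -- `Y` is listed in transitive order, each entry beating all later ones, so a transitive list
  -- dominated by `Y` can be appended at its end.
  LargeTransitive : List V → (V → Bool) → Set
  LargeTransitive L Q =
    ∃[ Y ] (AllPairs _⇾_ Y × Y ⊆ L × 3 * total-size Q L ≤ 7 * total-weight Q Y)

  -- Exactly what is needed for the tournament to stay Δ(1,2,2)-free when every heavy vertex is
  -- blown up to a copy of the 7-vertex Paley tournament.
  record Blowable (L : List V) (Q : V → Bool) : Set where
    field
      triangle-light : ∀ {v y z} → v ∈ L → y ∈ L → z ∈ L → Q v ≡ true →
        v ⇾ y → y ⇾ z → z ⇾ v → Q y ≡ false × Q z ≡ false
      out-unique : ∀ {v y z z′} → v ∈ L → y ∈ L → z ∈ L → z′ ∈ L → Q v ≡ true →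
        v ⇾ y → y ⇾ z → y ⇾ z′ → z ⇾ v → z′ ⇾ v → z ≡ z′
      in-unique : ∀ {v y y′ z} → v ∈ L → y ∈ L → y′ ∈ L → z ∈ L → Q v ≡ true →
        v ⇾ y → v ⇾ y′ → y ⇾ z → y′ ⇾ z → z ⇾ v → y ≡ y′

  Blowable-⊆ : ∀ {K L Q} → K ⊆ L → Blowable L Q → Blowable K Q
  Blowable-⊆ K⊆L b = record
    { triangle-light = λ v y z → triangle-light (K⊆L v) (K⊆L y) (K⊆L z)
    ; out-unique = λ v y z z′ → out-unique (K⊆L v) (K⊆L y) (K⊆L z) (K⊆L z′)
    ; in-unique = λ v y y′ z → in-unique (K⊆L v) (K⊆L y) (K⊆L y′) (K⊆L z)
    }
    where open Blowable b

  _∖_ : List V → List V → List V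
  L ∖ S = filter (λ x → ¬? (x ∈? S)) L

  ∈-∖⁺ : ∀ {L S x} → x ∈ L → x ∉ S → x ∈ L ∖ S
  ∈-∖⁺ {S = S} = ∈-filter⁺ (λ x → ¬? (x ∈? S))

  ∈-∖⁻ : ∀ {L S x} → x ∈ L ∖ S → x ∈ L × x ∉ S
  ∈-∖⁻ {S = S} = ∈-filter⁻ (λ x → ¬? (x ∈? S))

  ∖! : ∀ {L S} → Unique L → Unique (L ∖ S)
  ∖! {S = S} = filter⁺ (λ x → ¬? (x ∈? S))

  ∖-length : ∀ {L S x} → x ∈ L → x ∈ S → length (L ∖ S) < length L
  ∖-length {L} {S} {x} x∈L x∈S =
    filter-notAll _ L (Any.map (λ { refl x∉S → x∉S x∈S }) x∈L)

  total-size-∖ : ∀ Q {L} S → Unique L → total-size Q L ≤ total-size Q (L ∖ S) + total-size Q S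
  total-size-∖ Q {L} S L! = begin
    total-size Q L                              ≤⟨ sum-map-⊆ (size Q) L! cover ⟩
    total-size Q ((L ∖ S) ++ S)                 ≡⟨ cong sum (map-++ (size Q) (L ∖ S) S) ⟩
    sum (map (size Q) (L ∖ S) ++ map (size Q) S) ≡⟨ sum-++ (map (size Q) (L ∖ S)) _ ⟩
    total-size Q (L ∖ S) + total-size Q S       ∎
    where
    open ≤-Reasoning
    cover : L ⊆ (L ∖ S) ++ S
    cover {x} x∈L with x ∈? S
    ... | yes x∈S = ∈-++⁺ʳ (L ∖ S) x∈S
    ... | no  x∉S = ∈-++⁺ˡ (∈-∖⁺ x∈L x∉S)

  heavier : V → (V → Bool) → V → Bool
  heavier u Q v = ⌊ v ≟ u ⌋ ∨ Q v

  heavier-≢ : ∀ {u Q v} → v ≢ u → heavier u Q v ≡ Q v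
  heavier-≢ {u} {v = v} v≢u with v ≟ u
  ... | yes v≡u = ⊥-elim (v≢u v≡u)
  ... | no  _   = refl

  heavier-≡ : ∀ u Q → heavier u Q u ≡ true
  heavier-≡ u Q with u ≟ u
  ... | yes _   = refl
  ... | no  u≢u = ⊥-elim (u≢u refl)

  module _ {u : V} {Q : V → Bool} (light : Q u ≡ false) where

    size-heavier : ∀ {L} → Unique L → u ∈ L → total-size Q L + 6 ≡ total-size (heavier u Q) L
    size-heavier {L} L! u∈L = +-cancelʳ-≡ 1 _ _ (begin-equality
      total-size Q L + 6 + 1                        ≡⟨ +-assoc (total-size Q L) 6 1 ⟩
      total-size Q L + 7                            ≡⟨ cong (λ b → total-size Q L + (if b then 7 else 1)) (heavier-≡ u Q) ⟨
      total-size Q L + size (heavier u Q) u         ≡⟨ sum-map-∈ (λ v≢u → cong (if_then 7 else 1) (sym (heavier-≢ {Q = Q} v≢u))) L! u∈L ⟩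
      total-size (heavier u Q) L + size Q u         ≡⟨ cong (λ b → total-size (heavier u Q) L + (if b then 7 else 1)) light ⟩
      total-size (heavier u Q) L + 1                ∎)
      where open ≤-Reasoning

    -- The gain is 3 - 1 if `Y` contains `u` and nothing otherwise; hence an inequality here,
    -- against the equality for sizes.
    weight-heavier : ∀ {Y} → Unique Y → total-weight (heavier u Q) Y ≤ total-weight Q Y + 2
    weight-heavier {Y} Y! with u ∈? Y
    ... | no u∉Y = ≤-trans
      (≤-reflexive (sum-map-∉ (λ v≢u → cong (if_then 3 else 1) (heavier-≢ {Q = Q} v≢u)) u∉Y))
      (m≤m+n _ 2)
    ... | yes u∈Y = ≤-reflexive (+-cancelʳ-≡ 1 _ _ (begin-equality
      total-weight (heavier u Q) Y + 1                ≡⟨ cong (λ b → total-weight (heavier u Q) Y + (if b then 3 else 1)) light ⟨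
      total-weight (heavier u Q) Y + weight Q u       ≡⟨ sum-map-∈ (λ v≢u → cong (if_then 3 else 1) (heavier-≢ {Q = Q} v≢u)) Y! u∈Y ⟩
      total-weight Q Y + weight (heavier u Q) u       ≡⟨ cong (λ b → total-weight Q Y + (if b then 3 else 1)) (heavier-≡ u Q) ⟩
      total-weight Q Y + 3                            ≡⟨ +-assoc (total-weight Q Y) 2 1 ⟨
      total-weight Q Y + 2 + 1                        ∎))
      where open ≤-Reasoning

  AllPairs⇒Unique : ∀ {Y} → AllPairs _⇾_ Y → Unique Y
  AllPairs⇒Unique []       = []
  AllPairs⇒Unique (p ∷ ps) = All.map ⇾⇒≢ p ∷ AllPairs⇒Unique ps

  total-weight-++ : ∀ Q Y es → total-weight Q (Y ++ es) ≡ total-weight Q Y + total-weight Q es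
  total-weight-++ Q Y es =
    trans (cong sum (map-++ (weight Q) Y es)) (sum-++ (map (weight Q) Y) (map (weight Q) es))

  ++-⊆ : ∀ {X Y Z : List V} → X ⊆ Z → Y ⊆ Z → X ++ Y ⊆ Z
  ++-⊆ {X} X⊆ Y⊆ x∈ with ∈-++⁻ X x∈
  ... | inj₁ x∈X = X⊆ x∈X
  ... | inj₂ x∈Y = Y⊆ x∈Y

  -- Reductions that shorten the vertex list

  module Reduction (L : List V) (L! : Unique L) (Q : V → Bool) (blowable : Blowable L Q)
    (ih : ∀ K R → length K < length L → Unique K → Blowable K R → LargeTransitive K R) where

    open Blowable blowable
    open OutNeighbours L L!

    -- If `v` were heavy, two vertices of its blow-up together with `z`, `z′` and the apex `y` would
    -- form Δ(1,2,2). This is how all the named vertices of the later configurations are shown to be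
    -- light.
    light : ∀ {v y z z′} → v ∈ L → y ∈ L → z ∈ L → z′ ∈ L → v ⇾ y → y ⇾ z → y ⇾ z′ →
      z ⇾ v → z′ ⇾ v → z ≢ z′ → Q v ≡ false
    light {v} v∈ y∈ z∈ z′∈ vy yz yz′ zv z′v z≢z′ with Q v in eq
    ... | false = refl
    ... | true  = ⊥-elim (z≢z′ (out-unique v∈ y∈ z∈ z′∈ eq vy yz yz′ zv z′v))

    -- No edge goes from `es` out of `S`, so everything left beats all of `es`, which can be
    -- appended to the transitive set of the remainder. The vertex `r` witnesses that the remainder
    -- is shorter.
    delete : ∀ {r} (S es : List V) → r ∈ L → r ∈ S → es ⊆ S → es ⊆ L → AllPairs _⇾_ es →
      (∀ {e x} → e ∈ es → x ∈ L → e ⇾ x → x ∈ S) →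
      3 * total-size Q S ≤ 7 * total-weight Q es → LargeTransitive L Q
    delete S es r∈L r∈S es⊆S es⊆L es-trans closed S≤es
      with Y , Y-trans , Y⊆ , L∖S≤Y ←
             ih (L ∖ S) Q (∖-length r∈L r∈S) (∖! L!) (Blowable-⊆ (proj₁ ∘ ∈-∖⁻) blowable)
      = Y ++ es
      , AllPairs.++⁺ Y-trans es-trans (All.tabulate λ y∈ → All.tabulate λ e∈ → above (Y⊆ y∈) e∈)
      , ++-⊆ (proj₁ ∘ ∈-∖⁻ ∘ Y⊆) es⊆L
      , (begin
          3 * total-size Q L                                  ≤⟨ *-monoʳ-≤ 3 (total-size-∖ Q S L!) ⟩
          3 * (total-size Q (L ∖ S) + total-size Q S)         ≡⟨ *-distribˡ-+ 3 (total-size Q (L ∖ S)) _ ⟩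
          3 * total-size Q (L ∖ S) + 3 * total-size Q S       ≤⟨ +-mono-≤ L∖S≤Y S≤es ⟩
          7 * total-weight Q Y + 7 * total-weight Q es        ≡⟨ *-distribˡ-+ 7 (total-weight Q Y) _ ⟨
          7 * (total-weight Q Y + total-weight Q es)          ≡⟨ cong (7 *_) (total-weight-++ Q Y es) ⟨
          7 * total-weight Q (Y ++ es)                        ∎)
      where
      open ≤-Reasoning
      above : ∀ {y e} → y ∈ L ∖ S → e ∈ es → y ⇾ e
      above y∈ e∈ with y∈L , y∉S ← ∈-∖⁻ y∈ with total (λ { refl → y∉S (es⊆S e∈) })
      ... | inj₁ ye = ye
      ... | inj₂ ey = ⊥-elim (y∉S (closed e∈ y∈L ey))

    delete-light : ∀ {r} (S es : List V) → All (λ v → Q v ≡ false) S → r ∈ L → r ∈ S →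
      es ⊆ S → es ⊆ L → AllPairs _⇾_ es →
      (∀ {e x} → e ∈ es → x ∈ L → e ⇾ x → x ∈ S) →
      3 * length S ≤ 7 * length es → LargeTransitive L Q
    delete-light S es S-light r∈L r∈S es⊆S es⊆L es-trans closed S≤es =
      delete S es r∈L r∈S es⊆S es⊆L es-trans closed (begin
        3 * total-size Q S    ≡⟨ cong (3 *_) (total-size-light S-light) ⟩
        3 * length S          ≤⟨ S≤es ⟩
        7 * length es         ≤⟨ *-monoʳ-≤ 7 (length≤total-weight Q es) ⟩
        7 * total-weight Q es ∎)
      where open ≤-Reasoning

    deg0 : ∀ {r} → r ∈ L → (∀ {x} → x ∈ L → ¬ (r ⇾ x)) → LargeTransitive L Q
    deg0 {r} r∈L none =
      delete (r ∷ []) (r ∷ []) r∈L (here refl) (λ x∈ → x∈) (λ { (here refl) → r∈L }) ([] ∷ [])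
        (λ { (here refl) x∈L rx → ⊥-elim (none x∈L rx) }) (bound (Q r))
      where
      bound : ∀ b → 3 * ((if b then 7 else 1) + 0) ≤ 7 * ((if b then 3 else 1) + 0)
      -- A heavy sink attains the ratio 3/7 exactly.
      bound true  = toWitness {a? = 21 ≤? 21} _
      bound false = toWitness {a? = 3 ≤? 7} _

    -- Every out-neighbour of `u` returns to `r`. If `r` and `u` are light, removing both and
    -- keeping `r` suffices. If one of them is heavy, blowability leaves `w` as the only
    -- out-neighbour of `u` and makes the other two vertices of the triangle light: size 9 is
    -- removed and weight 4 kept, and 27 ≤ 28.
    deg1 : ∀ {r u w} → r ∈ L → u ∈ L → w ∈ L → r ⇾ u → u ⇾ w →
      (∀ {x} → x ∈ L → r ⇾ x → x ≡ u) → LargeTransitive L Q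
    deg1 {r} {u} {w} r∈L u∈L w∈L ru uw only = go (Q r) (Q u) refl refl
      where
      back : ∀ {x} → x ∈ L → u ⇾ x → x ⇾ r
      back x∈L ux with total (path⇒≢ ru ux)
      ... | inj₁ rx = ⊥-elim (⇾⇒≢ ux (sym (only x∈L rx)))
      ... | inj₂ xr = xr

      wr : w ⇾ r
      wr = back w∈L uw

      heavy-case : (∀ {x} → x ∈ L → u ⇾ x → x ≡ w) →
        3 * total-size Q (r ∷ u ∷ w ∷ []) ≤ 7 * total-weight Q (r ∷ u ∷ []) → LargeTransitive L Q
      heavy-case only-u =
        delete (r ∷ u ∷ w ∷ []) (r ∷ u ∷ []) r∈L (here refl)
          (λ { (here e) → here e ; (there (here e)) → there (here e) })
          (λ { (here refl) → r∈L ; (there (here refl)) → u∈L })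
          ((ru ∷ []) ∷ [] ∷ [])
          (λ { (here refl) x∈L rx → there (here (only x∈L rx))
             ; (there (here refl)) x∈L ux → there (there (here (only-u x∈L ux))) })

      go : ∀ b c → Q r ≡ b → Q u ≡ c → LargeTransitive L Q
      go false false Qr Qu =
        delete-light (r ∷ u ∷ []) (r ∷ []) (Qr ∷ Qu ∷ []) r∈L (here refl)
          (λ { (here e) → here e }) (λ { (here refl) → r∈L }) ([] ∷ [])
          (λ { (here refl) x∈L rx → there (here (only x∈L rx)) })
          (toWitness {a? = 6 ≤? 7} _)
      go true _ Qr _ with Qu , Qw ← triangle-light r∈L u∈L w∈L Qr ru uw wr =
        heavy-case
          (λ x∈L ux → sym (out-unique r∈L u∈L w∈L x∈L Qr ru uw ux wr (back x∈L ux)))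
          bound
        where
        bound : 3 * total-size Q (r ∷ u ∷ w ∷ []) ≤ 7 * total-weight Q (r ∷ u ∷ [])
        bound rewrite Qr | Qu | Qw = toWitness {a? = 27 ≤? 28} _
      go false true Qr Qu with Qw , _ ← triangle-light u∈L w∈L r∈L Qu uw wr ru =
        heavy-case
          (λ x∈L ux → sym (in-unique u∈L w∈L x∈L r∈L Qu uw ux wr (back x∈L ux) ru))
          bound
        where
        bound : 3 * total-size Q (r ∷ u ∷ w ∷ []) ≤ 7 * total-weight Q (r ∷ u ∷ [])
        bound rewrite Qr | Qu | Qw = toWitness {a? = 27 ≤? 28} _

    -- Minimum out-degree two

    module Deg2 (2≤deg : ∀ {v} → v ∈ L → 2 ≤ deg v) where

      -- Since `w` beats `u`, no out-neighbour of `u` is an out-neighbour of `r`, so all of them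
      -- return to `r`. Thus `u` again has out-degree exactly two, and the argument can be repeated
      -- with `u` in the role of `r`.
      next : ∀ {r w u} → u ∈ L → r ⇾ w → r ⇾ u → w ⇾ u →
        (∀ {x} → x ∈ L → r ⇾ x → x ∈ w ∷ u ∷ []) → Returns r w u []
      next {r} {w} {u} u∈L rw ru wu only = two-returns [] rw ru wu cover (2≤deg u∈L)
        where
        cover : ∀ {x} → x ∈ L → u ⇾ x → x ∈ [] ⊎ x ⇾ r
        cover x∈L ux with total (path⇒≢ ru ux)
        ... | inj₂ xr = inj₂ xr
        ... | inj₁ rx with only x∈L rx
        ...   | here refl         = ⊥-elim (asym wu ux)
        ...   | there (here refl) = ⊥-elim (⇾⇒≢ ux refl)

      -- {r, u₀, u₁, p, q} is the regular 5-vertex tournament, with no edge leaving it.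
      regular : ∀ {r u₀ u₁} → r ∈ L → u₀ ∈ L → u₁ ∈ L → r ⇾ u₀ → r ⇾ u₁ → u₀ ⇾ u₁ →
        (∀ {x} → x ∈ L → r ⇾ x → x ∈ u₀ ∷ u₁ ∷ []) →
        (R : Returns r u₀ u₁ []) → Returns.p R ⇾ Returns.q R → LargeTransitive L Q
      regular {r} {u₀} {u₁} r∈ u₀∈ u₁∈ ru₀ ru₁ u₀u₁ only-r
        record { p = p ; q = q ; p∈L = p∈ ; q∈L = q∈ ; up = u₁p ; uq = u₁q
               ; pr = pr ; qr = qr ; wp = u₀p ; qw = qu₀ ; only = only-u₁ } pq =
        delete-light (r ∷ u₀ ∷ u₁ ∷ p ∷ q ∷ []) (r ∷ u₀ ∷ u₁ ∷ [])
          ( light r∈ u₁∈ p∈ q∈ ru₁ u₁p u₁q pr qr (⇾⇒≢ pq)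
          ∷ light u₀∈ p∈ q∈ r∈ u₀p pq pr qu₀ ru₀ (⇾⇒≢ qr)
          ∷ light u₁∈ q∈ r∈ u₀∈ u₁q qr qu₀ ru₁ u₀u₁ (⇾⇒≢ ru₀)
          ∷ light p∈ r∈ u₀∈ u₁∈ pr ru₀ ru₁ u₀p u₁p (⇾⇒≢ u₀u₁)
          ∷ light q∈ u₀∈ u₁∈ p∈ qu₀ u₀u₁ u₀p u₁q pq (⇾⇒≢ u₁p)
          ∷ [])
          r∈ (here refl)
          (λ { (here e) → here e ; (there (here e)) → there (here e)
             ; (there (there (here e))) → there (there (here e)) })
          (λ { (here refl) → r∈ ; (there (here refl)) → u₀∈ ; (there (there (here refl))) → u₁∈ })
          ((ru₀ ∷ ru₁ ∷ []) ∷ (u₀u₁ ∷ []) ∷ [] ∷ [])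
          closed
          (toWitness {a? = 15 ≤? 21} _)
        where
        only-q : ∀ {x} → x ∈ L → q ⇾ x → x ∈ r ∷ u₀ ∷ []
        -- The step from `r` to `u₁` is repeated from `u₁` to `q`, and in `only-u₀` from `q` to
        -- `u₀`.
        only-q x∈ qx with next q∈ u₁p u₁q pq only-u₁
        ... | record { qw = q′p ; only = only′ }
          with only′ r∈ qr | only′ u₀∈ qu₀ | only′ x∈ qx
        ...   | there (here refl) | _                 | _                 = ⊥-elim (asym pr q′p)
        ...   | here refl         | here refl         | _                 = ⊥-elim (⇾⇒≢ ru₀ refl)
        ...   | here refl         | there (here refl) | here refl         = here refl
        ...   | here refl         | there (here refl) | there (here refl) = there (here refl)

        only-u₀ : ∀ {x} → x ∈ L → u₀ ⇾ x → x ∈ u₁ ∷ p ∷ []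
        only-u₀ x∈ u₀x with next u₀∈ qr qu₀ ru₀ only-q
        ... | record { only = only′ } with only′ u₁∈ u₀u₁ | only′ p∈ u₀p | only′ x∈ u₀x
        ...   | here refl         | here refl         | _                 = ⊥-elim (⇾⇒≢ u₁p refl)
        ...   | there (here refl) | there (here refl) | _                 = ⊥-elim (⇾⇒≢ u₁p refl)
        ...   | here refl         | there (here refl) | x∈                = x∈
        ...   | there (here refl) | here refl         | here refl         = there (here refl)
        ...   | there (here refl) | here refl         | there (here refl) = here refl

        closed : ∀ {e x} → e ∈ r ∷ u₀ ∷ u₁ ∷ [] → x ∈ L → e ⇾ x → x ∈ r ∷ u₀ ∷ u₁ ∷ p ∷ q ∷ []
        closed (here refl) x∈ ex with only-r x∈ ex
        ... | here e         = there (here e)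
        ... | there (here e) = there (there (here e))
        closed (there (here refl)) x∈ ex with only-u₀ x∈ ex
        ... | here e         = there (there (here e))
        ... | there (here e) = there (there (there (here e)))
        closed (there (there (here refl))) x∈ ex with only-u₁ x∈ ex
        ... | here e         = there (there (there (here e)))
        ... | there (here e) = there (there (there (there (here e))))

      -- The triangle C = r → u → p → r has no out-neighbours but D = {a, q, s}, to which it is
      -- matched, and D is a module of the rest. Contract C ∪ D to the heavy vertex a; the two units
      -- of weight that a loses when it is expanded again are recovered by the edge u → p.
      module TwoTriangles {r u p a q s : V}
        (r∈ : r ∈ L) (u∈ : u ∈ L) (p∈ : p ∈ L) (a∈ : a ∈ L) (q∈ : q ∈ L) (s∈ : s ∈ L)
        (ru : r ⇾ u) (up : u ⇾ p) (pr : p ⇾ r) (ra : r ⇾ a) (uq : u ⇾ q) (ps : p ⇾ s)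
        (au : a ⇾ u) (ap : a ⇾ p) (as : a ⇾ s) (qa : q ⇾ a) (qp : q ⇾ p) (qr : q ⇾ r)
        (sq : s ⇾ q) (su : s ⇾ u) (sr : s ⇾ r)
        (only-r : ∀ {x} → x ∈ L → r ⇾ x → x ∈ a ∷ u ∷ [])
        (only-u : ∀ {x} → x ∈ L → u ⇾ x → x ∈ p ∷ q ∷ [])
        (only-p : ∀ {x} → x ∈ L → p ⇾ x → x ∈ r ∷ s ∷ []) where

        S K : List V
        S = r ∷ u ∷ p ∷ q ∷ s ∷ []
        K = L ∖ S

        a∈K : a ∈ K
        a∈K = ∈-∖⁺ a∈ λ
          { (here refl)                                 → ⇾⇒≢ ra refl
          ; (there (here refl))                         → ⇾⇒≢ au refl
          ; (there (there (here refl)))                 → ⇾⇒≢ ap refl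
          ; (there (there (there (here refl))))         → ⇾⇒≢ qa refl
          ; (there (there (there (there (here refl))))) → ⇾⇒≢ as refl }

        K⊆L : K ⊆ L
        K⊆L = proj₁ ∘ ∈-∖⁻

        K⇾u : ∀ {x} → x ∈ K → x ⇾ u
        K⇾u x∈K with x∈L , x∉S ← ∈-∖⁻ x∈K with total (λ x≡u → x∉S (there (here x≡u)))
        ... | inj₁ xu = xu
        ... | inj₂ ux with only-u x∈L ux
        ...   | here e         = ⊥-elim (x∉S (there (there (here e))))
        ...   | there (here e) = ⊥-elim (x∉S (there (there (there (here e)))))

        K⇾p : ∀ {x} → x ∈ K → x ⇾ p
        K⇾p x∈K with x∈L , x∉S ← ∈-∖⁻ x∈K with total (λ x≡p → x∉S (there (there (here x≡p))))
        ... | inj₁ xp = xp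
        ... | inj₂ px with only-p x∈L px
        ...   | here e         = ⊥-elim (x∉S (here e))
        ...   | there (here e) = ⊥-elim (x∉S (there (there (there (there (here e))))))

        K⇾r : ∀ {x} → x ∈ K → x ≢ a → x ⇾ r
        K⇾r x∈K x≢a with x∈L , x∉S ← ∈-∖⁻ x∈K with total (λ x≡r → x∉S (here x≡r))
        ... | inj₁ xr = xr
        ... | inj₂ rx with only-r x∈L rx
        ...   | here e         = ⊥-elim (x≢a e)
        ...   | there (here e) = ⊥-elim (x∉S (there (here e)))

        x≢q : ∀ {x} → x ∈ K → x ≢ q
        x≢q x∈K e = proj₂ (∈-∖⁻ {L} {S} x∈K) (there (there (there (here e))))

        x≢s : ∀ {x} → x ∈ K → x ≢ s
        x≢s x∈K e = proj₂ (∈-∖⁻ {L} {S} x∈K) (there (there (there (there (here e)))))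

        -- This and the next two implications close a cycle, so `a`, `q`, `s` have the same
        -- out-neighbours in `K` apart from `a`. Each failure gives Δ(1,2,2) whose apex is in D and
        -- which uses the vertex of C matched to that apex.
        a⇾⇒q⇾ : ∀ {x} → x ∈ K → a ⇾ x → q ⇾ x
        a⇾⇒q⇾ x∈K ax with total (x≢q x∈K)
        ... | inj₂ qx = qx
        ... | inj₁ xq = ⊥-elim (free (≢-sym (x≢s x∈K)) (≢-sym (⇾⇒≢ qr)) as ax sr sq
                                  (K⇾r x∈K (≢-sym (⇾⇒≢ ax))) xq ra qa)

        q⇾⇒s⇾ : ∀ {x} → x ∈ K → x ≢ a → q ⇾ x → s ⇾ x
        q⇾⇒s⇾ x∈K x≢a qx with total (x≢s x∈K)
        ... | inj₂ sx = sx
        ... | inj₁ xs = ⊥-elim (free (≢-sym x≢a) (≢-sym (⇾⇒≢ su)) qa qx au as (K⇾u x∈K) xs uq sq)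

        s⇾⇒a⇾ : ∀ {x} → x ∈ K → x ≢ a → s ⇾ x → a ⇾ x
        s⇾⇒a⇾ x∈K x≢a sx with total x≢a
        ... | inj₂ ax = ax
        ... | inj₁ xa = ⊥-elim (free (≢-sym (x≢q x∈K)) (≢-sym (⇾⇒≢ ap)) sq sx qp qa
                                  (K⇾p x∈K) xa ps as)

        a⇾⇒s⇾ : ∀ {x} → x ∈ K → a ⇾ x → s ⇾ x
        a⇾⇒s⇾ x∈K ax = q⇾⇒s⇾ x∈K (≢-sym (⇾⇒≢ ax)) (a⇾⇒q⇾ x∈K ax)

        ⇾a⇒⇾s : ∀ {x} → x ∈ K → x ⇾ a → x ⇾ s
        ⇾a⇒⇾s x∈K xa with total (x≢s x∈K)
        ... | inj₁ xs = xs
        ... | inj₂ sx = ⊥-elim (asym xa (s⇾⇒a⇾ x∈K (⇾⇒≢ xa) sx))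

        a-light : Q a ≡ false
        a-light = light a∈ s∈ q∈ r∈ as sq sr qa ra (⇾⇒≢ qr)

        -- By the module property `s` is a twin of `a` towards `y` and `z`. The pair `a`, `s` then
        -- plays the part of two vertices in a blow-up of `a`, and a heavy `y` or `z` would violate
        -- blowability of `L`.
        triangle-at-a : ∀ {y z} → y ∈ K → z ∈ K → a ⇾ y → y ⇾ z → z ⇾ a →
          Q y ≡ false × Q z ≡ false
        triangle-at-a {y} {z} y∈ z∈ ay yz za = y-light , z-light
          where
          sy = a⇾⇒s⇾ y∈ ay
          zs = ⇾a⇒⇾s z∈ za
          y-light : Q y ≡ false
          y-light = light (K⊆L y∈) (K⊆L z∈) a∈ s∈ yz za zs ay sy (⇾⇒≢ as)
          z-light : Q z ≡ false
          z-light with Q z in eq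
          ... | false = refl
          ... | true  = ⊥-elim (⇾⇒≢ as (in-unique (K⊆L z∈) a∈ s∈ (K⊆L y∈) eq za zs ay sy yz))

        Q⁺ : V → Bool
        Q⁺ = heavier a Q

        Q⁺-light : ∀ {v} → v ≢ a → Q v ≡ false → Q⁺ v ≡ false
        Q⁺-light v≢a Qv = trans (heavier-≢ {Q = Q} v≢a) Qv

        heavy≢light : ∀ {v} → Q v ≡ true → Q v ≡ false → ⊥
        heavy≢light eq eq′ with () ← trans (sym eq) eq′

        -- At `v = a` a violation becomes Δ(1,2,2) in the original tournament, with the twin `s` as
        -- second copy of `a`. At another heavy `v` the conditions are inherited; a cyclic triangle
        -- through `v` and `a` is excluded by `triangle-at-a`.
        K-blowable : Blowable K Q⁺
        K-blowable = record
          { triangle-light = triangle-light⁺ ; out-unique = out-unique⁺ ; in-unique = in-unique⁺ }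
          where
          triangle-light⁺ : ∀ {v y z} → v ∈ K → y ∈ K → z ∈ K → Q⁺ v ≡ true →
            v ⇾ y → y ⇾ z → z ⇾ v → Q⁺ y ≡ false × Q⁺ z ≡ false
          triangle-light⁺ {v} {y} {z} v∈ y∈ z∈ Qv vy yz zv with v ≟ a
          ... | yes refl = let Qy , Qz = triangle-at-a y∈ z∈ vy yz zv in
            Q⁺-light (≢-sym (⇾⇒≢ vy)) Qy , Q⁺-light (⇾⇒≢ zv) Qz
          ... | no _ with y ≟ a | z ≟ a
          ...   | yes refl | _        =
            ⊥-elim (heavy≢light Qv (proj₂ (triangle-at-a z∈ v∈ yz zv vy)))
          ...   | no _     | yes refl =
            ⊥-elim (heavy≢light Qv (proj₁ (triangle-at-a v∈ y∈ zv vy yz)))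
          ...   | no _     | no _     =
            triangle-light (K⊆L v∈) (K⊆L y∈) (K⊆L z∈) Qv vy yz zv

          out-unique⁺ : ∀ {v y z z′} → v ∈ K → y ∈ K → z ∈ K → z′ ∈ K → Q⁺ v ≡ true →
            v ⇾ y → y ⇾ z → y ⇾ z′ → z ⇾ v → z′ ⇾ v → z ≡ z′
          out-unique⁺ {v} {y} {z} {z′} v∈ y∈ z∈ z′∈ Qv vy yz yz′ zv z′v with v ≟ a | z ≟ z′
          ... | _        | yes z≡z′ = z≡z′
          ... | yes refl | no z≢z′  = ⊥-elim (free z≢z′ (⇾⇒≢ as) yz yz′ zv (⇾a⇒⇾s z∈ zv)
                                                z′v (⇾a⇒⇾s z′∈ z′v) vy (a⇾⇒s⇾ y∈ vy))
          ... | no _     | no _     =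
            out-unique (K⊆L v∈) (K⊆L y∈) (K⊆L z∈) (K⊆L z′∈) Qv vy yz yz′ zv z′v

          in-unique⁺ : ∀ {v y y′ z} → v ∈ K → y ∈ K → y′ ∈ K → z ∈ K → Q⁺ v ≡ true →
            v ⇾ y → v ⇾ y′ → y ⇾ z → y′ ⇾ z → z ⇾ v → y ≡ y′
          in-unique⁺ {v} {y} {y′} {z} v∈ y∈ y′∈ z∈ Qv vy vy′ yz y′z zv with v ≟ a | y ≟ y′
          ... | _        | yes y≡y′ = y≡y′
          ... | yes refl | no y≢y′  = ⊥-elim (free (⇾⇒≢ as) y≢y′ zv (⇾a⇒⇾s z∈ zv) vy vy′
                                                (a⇾⇒s⇾ y∈ vy) (a⇾⇒s⇾ y′∈ vy′) yz y′z)
          ... | no _     | no _     =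
            in-unique (K⊆L v∈) (K⊆L y∈) (K⊆L y′∈) (K⊆L z∈) Qv vy vy′ yz y′z zv

        S-light : All (λ v → Q v ≡ false) S
        S-light = light r∈ u∈ p∈ q∈ ru up uq pr qr (≢-sym (⇾⇒≢ qp))
                ∷ light u∈ p∈ r∈ s∈ up pr ps ru su (≢-sym (⇾⇒≢ sr))
                ∷ light p∈ r∈ a∈ u∈ pr ra ru ap up (⇾⇒≢ au)
                ∷ light q∈ a∈ u∈ s∈ qa au as uq sq (≢-sym (⇾⇒≢ su))
                ∷ light s∈ q∈ a∈ p∈ sq qa qp as ps (⇾⇒≢ ap)
                ∷ []

        contract : LargeTransitive L Q
        contract with Y , Y-trans , Y⊆ , K≤Y ← ih K Q⁺ (∖-length r∈ (here refl)) (∖! L!) K-blowable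
          = Y ++ u ∷ p ∷ []
          , AllPairs.++⁺ Y-trans ((up ∷ []) ∷ [] ∷ [])
              (All.tabulate λ y∈ → K⇾u (Y⊆ y∈) ∷ K⇾p (Y⊆ y∈) ∷ [])
          , ++-⊆ (K⊆L ∘ Y⊆) (λ { (here refl) → u∈ ; (there (here refl)) → p∈ })
          , (begin
              3 * total-size Q L                           ≤⟨ *-monoʳ-≤ 3 L≤K ⟩
              3 * total-size Q⁺ K                          ≤⟨ K≤Y ⟩
              7 * total-weight Q⁺ Y                        ≤⟨ *-monoʳ-≤ 7 (weight-heavier a-light (AllPairs⇒Unique Y-trans)) ⟩
              7 * (total-weight Q Y + 2)                   ≤⟨ *-monoʳ-≤ 7 (+-monoʳ-≤ (total-weight Q Y) (length≤total-weight Q (u ∷ p ∷ []))) ⟩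
              7 * (total-weight Q Y + total-weight Q (u ∷ p ∷ [])) ≡⟨ cong (7 *_) (total-weight-++ Q Y _) ⟨
              7 * total-weight Q (Y ++ u ∷ p ∷ [])         ∎)
          where
          open ≤-Reasoning
          L≤K : total-size Q L ≤ total-size Q⁺ K
          L≤K = begin
            total-size Q L                     ≤⟨ total-size-∖ Q S L! ⟩
            total-size Q K + total-size Q S    ≡⟨ cong (total-size Q K +_) (total-size-light S-light) ⟩
            -- Five light vertices disappear while `a` grows from 1 to 7, leaving one unit to spare.
            total-size Q K + 5                 ≤⟨ +-monoʳ-≤ (total-size Q K) (toWitness {a? = 5 ≤? 6} _) ⟩
            total-size Q K + 6                 ≡⟨ size-heavier a-light (∖! L!) a∈K ⟩
            total-size Q⁺ K                    ∎

      deg2 : ∀ {r u₀ u₁} → r ∈ L → u₀ ∈ L → u₁ ∈ L → r ⇾ u₀ → r ⇾ u₁ → u₀ ⇾ u₁ →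
        (∀ {x} → x ∈ L → r ⇾ x → x ∈ u₀ ∷ u₁ ∷ []) → LargeTransitive L Q
      deg2 {r} {u₀} {u₁} r∈ u₀∈ u₁∈ ru₀ ru₁ u₀u₁ only-r
        with next u₁∈ ru₀ ru₁ u₀u₁ only-r
      ... | R@record { p = p ; q = q ; p∈L = p∈ ; q∈L = q∈ ; up = u₁p ; uq = u₁q
                     ; pr = pr ; qr = qr ; wp = u₀p ; qw = qu₀ ; only = only-u₁ }
        with total (≢-sym (path⇒≢ qu₀ u₀p))
      ...   | inj₁ pq = regular r∈ u₀∈ u₁∈ ru₀ ru₁ u₀u₁ only-r R pq
      -- Going on from `u₁` to `p` yields `s`, the last of the six vertices; the other out-neighbour
      -- of `p` must be `r`.
      ...   | inj₂ qp with next p∈ u₁q u₁p qp (λ x∈ ux → swap (only-u₁ x∈ ux))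
        where
        swap : ∀ {x} → x ∈ p ∷ q ∷ [] → x ∈ q ∷ p ∷ []
        swap (here e)         = there (here e)
        swap (there (here e)) = here e
      ...     | record { q = s ; q∈L = s∈ ; uq = ps ; qr = su₁ ; qw = sq ; only = only-p }
        with only-p r∈ pr
      ...       | there (here refl) = ⊥-elim (asym qr sq)
      ...       | here refl
        with total (path⇒≢ sq qr)
      ...         | inj₂ rs = ⊥-elim (absurd (only-r s∈ rs))
        where
        absurd : s ∉ u₀ ∷ u₁ ∷ []
        absurd (here refl)         = asym u₀p ps
        absurd (there (here refl)) = ⇾⇒≢ su₁ refl
      ...         | inj₁ sr =
        TwoTriangles.contract r∈ u₁∈ p∈ u₀∈ q∈ s∈ ru₁ u₁p pr ru₀ u₁q ps u₀u₁ u₀p u₀s qu₀ qp qr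
          sq su₁ sr only-r only-u₁ only-p
        where
        only-p′ : ∀ {x} → x ∈ L → p ⇾ x → x ∈ s ∷ r ∷ []
        only-p′ x∈ px with only-p x∈ px
        ... | here e         = there (here e)
        ... | there (here e) = here e
        u₀s : u₀ ⇾ s
        u₀s with next r∈ ps pr sr only-p′
        -- A further step, from `p` to `r`, recovers the known out-neighbours `u₀`, `u₁` of `r`; as
        -- `s` beats `u₁`, the one that beats `s` is `u₀`.
        ... | record { qw = q₃s ; only = only₃ } with only₃ u₁∈ ru₁ | only₃ u₀∈ ru₀
        ...   | there (here refl) | _                 = ⊥-elim (asym su₁ q₃s)
        ...   | here refl         | here refl         = ⊥-elim (⇾⇒≢ u₀u₁ refl)
        ...   | here refl         | there (here refl) = q₃s

    -- Minimum out-degree three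

    -- {r, a, b, c, q₁, q₂, q₃} is the Paley tournament, with no edge leaving it.
    deg3 : (∀ {v} → v ∈ L → 3 ≤ deg v) → ∀ {r a b c} → r ∈ L → a ∈ L → b ∈ L → c ∈ L →
      r ⇾ a → r ⇾ b → r ⇾ c → a ⇾ b → b ⇾ c → c ⇾ a →
      (∀ {x} → x ∈ L → r ⇾ x → x ∈ a ∷ b ∷ c ∷ []) → LargeTransitive L Q
    deg3 3≤deg {r} {a} {b} {c} r∈ a∈ b∈ c∈ ra rb rc ab bc ca only-r
      with next a∈ b∈ ra rc ca ab rotate₁ | next b∈ c∈ rb ra ab bc rotate₂ | next c∈ a∈ rc rb bc ca only-r
      where
      rotate₁ : ∀ {x} → x ∈ L → r ⇾ x → x ∈ b ∷ c ∷ a ∷ []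
      rotate₁ x∈ rx with only-r x∈ rx
      ... | here e                 = there (there (here e))
      ... | there (here e)         = here e
      ... | there (there (here e)) = there (here e)
      rotate₂ : ∀ {x} → x ∈ L → r ⇾ x → x ∈ c ∷ a ∷ b ∷ []
      rotate₂ x∈ rx with rotate₁ x∈ rx
      ... | here e                 = there (there (here e))
      ... | there (here e)         = here e
      ... | there (there (here e)) = there (here e)
      next : ∀ {u v w} → u ∈ L → v ∈ L → r ⇾ u → r ⇾ w → w ⇾ u → u ⇾ v →
        (∀ {x} → x ∈ L → r ⇾ x → x ∈ v ∷ w ∷ u ∷ []) → Returns r w u (v ∷ [])
      next {u} {v} {w} u∈ v∈ ru rw wu uv only = two-returns (v ∷ []) rw ru wu cover (3≤deg u∈)
        where
        cover : ∀ {x} → x ∈ L → u ⇾ x → x ∈ v ∷ [] ⊎ x ⇾ r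
        cover x∈ ux with total (path⇒≢ ru ux)
        ... | inj₂ xr = inj₂ xr
        ... | inj₁ rx with only x∈ rx
        ...   | here e                    = inj₁ (here e)
        ...   | there (here refl)         = ⊥-elim (asym wu ux)
        ...   | there (there (here refl)) = ⊥-elim (⇾⇒≢ ux refl)
    ... | record { p = p₁ ; q = q₁ ; p∈L = p₁∈ ; q∈L = q₁∈ ; up = ap₁ ; uq = aq₁ ; pr = p₁r ; qr = q₁r
                 ; wp = cp₁ ; qw = q₁c ; only = only-a }
        | record { p = p₂ ; q = q₂ ; p∈L = p₂∈ ; q∈L = q₂∈ ; up = bp₂ ; uq = bq₂ ; pr = p₂r ; qr = q₂r
                 ; wp = ap₂ ; qw = q₂a ; only = only-b }
        | record { p = p₃ ; q = q₃ ; p∈L = p₃∈ ; q∈L = q₃∈ ; up = cp₃ ; uq = cq₃ ; pr = p₃r ; qr = q₃r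
                 ; wp = bp₃ ; qw = q₃b ; only = only-c }
      with only-a p₂∈ ap₂
    ... | there (there (here refl)) = ⊥-elim (⇾⇒≢ bp₂ refl)
    -- If `p₁ = p₂`, this vertex is dominated by `a`, `b` and `c`. It then beats `r`, `q₂` and `q₃`,
    -- all of which beat `a`: three returns, seen from `a`.
    ... | here refl = ⊥-elim (common (only-c p₁∈ cp₁))
      where
      -- A vertex with at most three out-neighbours itself has minimum out-degree, so `indegree≤1`
      -- applies around it instead of `r`.
      at-most-one : ∀ {v w y z t₁ t₂ t₃} →
        (∀ {x} → x ∈ L → v ⇾ x → x ∈ t₁ ∷ t₂ ∷ t₃ ∷ []) →
        w ∈ L → y ∈ L → z ∈ L → v ⇾ w → v ⇾ y → v ⇾ z → y ≢ z → y ⇾ w → ¬ (z ⇾ w)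
      at-most-one only w∈ y∈ z∈ vw vy vz =
        indegree≤1
          (λ x∈ → ≤-trans
            (length-⊆ out! λ t∈ → let t∈L , vt = ∈-out⁻ t∈ in only t∈L vt) (3≤deg x∈))
          (∈-out⁺ w∈ vw) (∈-out⁺ y∈ vy) (∈-out⁺ z∈ vz)
      common : p₁ ∉ p₃ ∷ q₃ ∷ a ∷ []
      common (there (here refl))         = asym bp₂ q₃b
      common (there (there (here refl))) = ⇾⇒≢ ap₁ refl
      common (here refl) =
        ¬three-returns ab ap₁ bp₂ (≢-sym (⇾⇒≢ q₂r)) (≢-sym (⇾⇒≢ q₃r)) (≢-sym (path⇒≢ q₃b bq₂))
          p₁r p₁q₂ p₁q₃ ra q₂a q₃a
        where
        p₁q₂ : p₁ ⇾ q₂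
        p₁q₂ with total (≢-sym (path⇒≢ q₂a ap₁))
        ... | inj₁ e = e
        ... | inj₂ e = ⊥-elim (at-most-one only-b p₁∈ c∈ q₂∈ bp₂ bc bq₂ (≢-sym (path⇒≢ q₂r rc)) cp₁ e)
        p₁q₃ : p₁ ⇾ q₃
        p₁q₃ with total (≢-sym (path⇒≢ q₃b bp₂))
        ... | inj₁ e = e
        ... | inj₂ e = ⊥-elim (at-most-one only-c p₁∈ a∈ q₃∈ cp₁ ca cq₃ (≢-sym (path⇒≢ q₃r ra)) ap₁ e)
        q₃a : q₃ ⇾ a
        q₃a with total (path⇒≢ q₃r ra)
        ... | inj₁ e = e
        ... | inj₂ e with only-a q₃∈ e
        ...   | here refl                 = ⊥-elim (asym bp₂ q₃b)
        ...   | there (here refl)         = ⊥-elim (asym q₁c cq₃)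
        ...   | there (there (here refl)) = ⊥-elim (⇾⇒≢ q₃b refl)
    -- Here `p₂ = q₁`. The same comparison at `b` and `c` forces `p₃ = q₂` and `p₁ = q₃`, leaving
    -- only three vertices beyond `r`, `a`, `b`, `c`.
    ... | there (here refl) with only-b p₃∈ bp₃
    ...   | here refl                 = ⊥-elim (asym q₁c cp₃)
    ...   | there (there (here refl)) = ⊥-elim (⇾⇒≢ cp₃ refl)
    ...   | there (here refl) with only-c p₁∈ cp₁
    ...     | here refl                 = ⊥-elim (asym q₂a ap₁)
    ...     | there (there (here refl)) = ⊥-elim (⇾⇒≢ ap₁ refl)
    ...     | there (here refl) =
      delete-light (r ∷ a ∷ b ∷ c ∷ q₁ ∷ q₂ ∷ q₃ ∷ []) (r ∷ a ∷ b ∷ [])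
        ( light r∈ a∈ q₁∈ q₃∈ ra aq₁ ap₁ q₁r q₃r (path⇒≢ q₁c cq₃)
        ∷ light a∈ b∈ c∈ q₂∈ ab bc bq₂ ca q₂a (≢-sym (path⇒≢ q₂r rc))
        ∷ light b∈ c∈ a∈ q₃∈ bc ca cq₃ ab q₃b (≢-sym (path⇒≢ q₃r ra))
        ∷ light c∈ a∈ b∈ q₁∈ ca ab aq₁ bc q₁c (≢-sym (path⇒≢ q₁r rb))
        ∷ light q₁∈ r∈ a∈ b∈ q₁r ra rb aq₁ bp₂ (⇾⇒≢ ab)
        ∷ light q₂∈ r∈ b∈ c∈ q₂r rb rc bq₂ cp₃ (⇾⇒≢ bc)
        ∷ light q₃∈ r∈ c∈ a∈ q₃r rc ra cq₃ ap₁ (⇾⇒≢ ca)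
        ∷ [])
        r∈ (here refl)
        (λ { (here e) → here e ; (there (here e)) → there (here e)
           ; (there (there (here e))) → there (there (here e)) })
        (λ { (here refl) → r∈ ; (there (here refl)) → a∈ ; (there (there (here refl))) → b∈ })
        ((ra ∷ rb ∷ []) ∷ (ab ∷ []) ∷ [] ∷ [])
        closed
        (toWitness {a? = 21 ≤? 21} _)
      where
      closed : ∀ {e x} → e ∈ r ∷ a ∷ b ∷ [] → x ∈ L → e ⇾ x →
        x ∈ r ∷ a ∷ b ∷ c ∷ q₁ ∷ q₂ ∷ q₃ ∷ []
      closed (here refl) x∈ ex = there (∈-++⁺ˡ (only-r x∈ ex))
      closed (there (here refl)) x∈ ex with only-a x∈ ex
      ... | here e                 = there (there (there (there (there (there (here e))))))
      ... | there (here e)         = there (there (there (there (here e))))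
      ... | there (there (here e)) = there (there (here e))
      closed (there (there (here refl))) x∈ ex with only-b x∈ ex
      ... | here e                 = there (there (there (there (here e))))
      ... | there (here e)         = there (there (there (there (there (here e)))))
      ... | there (there (here e)) = there (there (there (here e)))

    -- Case distinction on the minimum out-degree

    reduce : ∀ {r} → r ∈ L → (∀ {v} → v ∈ L → deg r ≤ deg v) → LargeTransitive L Q
    reduce {r} r∈ minimal = go (out r) refl
      where
      out≡ : ∀ {xs} → out r ≡ xs →
        (∀ {x} → x ∈ xs → x ∈ L × r ⇾ x) × (∀ {x} → x ∈ L → r ⇾ x → x ∈ xs) ×
        (∀ {v} → v ∈ L → length xs ≤ deg v) × Unique xs
      out≡ refl = ∈-out⁻ , ∈-out⁺ , minimal , out!

      one : ∀ {xs x y z} → out r ≡ xs → x ∈ xs → y ∈ xs → z ∈ xs → x ≢ y → x ⇾ z → ¬ (y ⇾ z)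
      one refl x∈ y∈ z∈ = indegree≤1 minimal z∈ x∈ y∈

      -- A transitive triple would have a last vertex with two in-neighbours among the
      -- out-neighbours of `r`.
      cyclic : ∀ {xs a b c} → out r ≡ xs → a ∈ xs → b ∈ xs → c ∈ xs → a ≢ b → a ≢ c → b ≢ c →
        (a ⇾ b × b ⇾ c × c ⇾ a) ⊎ (b ⇾ a × a ⇾ c × c ⇾ b)
      cyclic eq a∈ b∈ c∈ a≢b a≢c b≢c with total a≢b | total b≢c | total a≢c
      ... | inj₁ ab | inj₁ bc | inj₁ ac = ⊥-elim (one eq a∈ b∈ c∈ a≢b ac bc)
      ... | inj₁ ab | inj₁ bc | inj₂ ca = inj₁ (ab , bc , ca)
      ... | inj₁ ab | inj₂ cb | _       = ⊥-elim (one eq a∈ c∈ b∈ a≢c ab cb)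
      ... | inj₂ ba | inj₁ bc | inj₁ ac = ⊥-elim (one eq a∈ b∈ c∈ a≢b ac bc)
      ... | inj₂ ba | inj₂ cb | inj₁ ac = inj₂ (ba , ac , cb)
      ... | inj₂ ba | _       | inj₂ ca = ⊥-elim (one eq b∈ c∈ a∈ b≢c ba ca)

      -- To keep in-degrees at most one, `b` must beat `e`; then whichever of `c` and `e` loses
      -- their edge has `b` as a second in-neighbour.
      no-fourth : ∀ {xs a b c e} → out r ≡ xs → a ∈ xs → b ∈ xs → c ∈ xs → e ∈ xs →
        a ≢ e → b ≢ e → c ≢ e → a ⇾ b → b ⇾ c → ⊥
      no-fourth eq a∈ b∈ c∈ e∈ a≢e b≢e c≢e ab bc with total b≢e | total c≢e
      ... | inj₂ eb | _       = one eq a∈ e∈ b∈ a≢e ab eb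
      ... | inj₁ be | inj₁ ce = one eq b∈ c∈ e∈ (⇾⇒≢ bc) be ce
      ... | inj₁ be | inj₂ ec = one eq b∈ e∈ c∈ b≢e bc ec

      go : ∀ xs → out r ≡ xs → LargeTransitive L Q
      go [] eq with out≡ eq
      ... | _ , only , _ = deg0 r∈ λ x∈ rx → ¬Any[] (only x∈ rx)
      go (u ∷ []) eq with out≡ eq
      ... | out⁻ , only , 1≤deg , _ with u∈ , ru ← out⁻ (here refl) with out u in eq-u | 1≤deg u∈
      ...   | w ∷ _ | _ with w∈ , uw ← ∈-out⁻ (subst (w ∈_) (sym eq-u) (here refl)) =
        deg1 r∈ u∈ w∈ ru uw λ x∈ rx → singleton (only x∈ rx)
        where
        singleton : ∀ {x} → x ∈ u ∷ [] → x ≡ u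
        singleton (here e) = e
      go (u ∷ v ∷ []) eq with out≡ eq
      ... | out⁻ , only , 2≤deg , (u≢v ∷ _) ∷ _
        with u∈ , ru ← out⁻ (here refl) with v∈ , rv ← out⁻ (there (here refl)) with total u≢v
      ...   | inj₁ uv = Deg2.deg2 2≤deg r∈ u∈ v∈ ru rv uv only
      ...   | inj₂ vu = Deg2.deg2 2≤deg r∈ v∈ u∈ rv ru vu λ x∈ rx → swap (only x∈ rx)
        where
        swap : ∀ {x} → x ∈ u ∷ v ∷ [] → x ∈ v ∷ u ∷ []
        swap (here e)         = there (here e)
        swap (there (here e)) = here e
      go (a ∷ b ∷ c ∷ []) eq with out≡ eq
      ... | out⁻ , only , 3≤deg , (a≢b ∷ a≢c ∷ _) ∷ (b≢c ∷ _) ∷ _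
        with a∈ , ra ← out⁻ (here refl)
        with b∈ , rb ← out⁻ (there (here refl))
        with c∈ , rc ← out⁻ (there (there (here refl)))
        with cyclic eq (here refl) (there (here refl)) (there (there (here refl))) a≢b a≢c b≢c
      ...   | inj₁ (ab , bc , ca) = deg3 3≤deg r∈ a∈ b∈ c∈ ra rb rc ab bc ca only
      ...   | inj₂ (ba , ac , cb) =
        deg3 3≤deg r∈ b∈ a∈ c∈ rb ra rc ba ac cb λ x∈ rx → swap (only x∈ rx)
        where
        swap : ∀ {x} → x ∈ a ∷ b ∷ c ∷ [] → x ∈ b ∷ a ∷ c ∷ []
        swap (here e)                 = there (here e)
        swap (there (here e))         = here e
        swap (there (there (here e))) = there (there (here e))
      go (a ∷ b ∷ c ∷ e ∷ _) eq with out≡ eq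
      ... | _ , _ , _ , (a≢b ∷ a≢c ∷ a≢e ∷ _) ∷ (b≢c ∷ b≢e ∷ _) ∷ (c≢e ∷ _) ∷ _
        with cyclic eq (here refl) (there (here refl)) (there (there (here refl))) a≢b a≢c b≢c
      ...   | inj₁ (ab , bc , _) = ⊥-elim
        (no-fourth eq (here refl) (there (here refl)) (there (there (here refl)))
          (there (there (there (here refl)))) a≢e b≢e c≢e ab bc)
      ...   | inj₂ (ba , ac , _) = ⊥-elim
        (no-fourth eq (there (here refl)) (here refl) (there (there (here refl)))
          (there (there (there (here refl)))) b≢e a≢e c≢e ba ac)

  -- The bound `n` on the length makes the recursion structural. All heavy sets are treated at once,
  -- because contraction enlarges the heavy set.
  large-transitive : ∀ n L Q → length L ≤ n → Unique L → Blowable L Q → LargeTransitive L Q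
  large-transitive _       []         Q _    _  _ = [] , [] , (λ ()) , z≤n
  large-transitive (suc n) L@(v ∷ vs) Q L≤n L! blowable = reduce r∈L minimal
    where
    open OutNeighbours L L!
    open Reduction L L! Q blowable
      (λ K R K<L → large-transitive n K R (≤-pred (<-≤-trans K<L L≤n)))
    r : V
    r = argmin deg v vs
    r∈L : r ∈ L
    r∈L with argmin-sel deg v vs
    ... | inj₁ r≡v  = here r≡v
    ... | inj₂ r∈vs = there r∈vs
    minimal : ∀ {x} → x ∈ L → deg r ≤ deg x
    minimal (here refl) = f[argmin]≤f[⊤] {f = deg} v vs
    minimal (there x∈)  = All.lookup (f[argmin]≤f[xs] {f = deg} v vs) x∈

-- Translation to Boolean tournaments

module _ {n} (T : Tournament n) where

  _⇾_ : Fin n → Fin n → Set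
  x ⇾ y = adj T x y ≡ true

  ⇾-irrefl : ∀ {x} → ¬ (x ⇾ x)
  ⇾-irrefl {x} xx with () ← trans (sym xx) (irrefl T x)

  rev : ∀ {x y} → x ⇾ y → adj T y x ≡ false
  rev {x} {y} xy =
    trans (tourn T y x λ { refl → ⇾-irrefl xy }) (cong not xy)

  ⇾-asym : ∀ {x y} → x ⇾ y → ¬ (y ⇾ x)
  ⇾-asym xy yx with () ← trans (sym yx) (rev xy)

  ⇾-total : ∀ {x y} → x ≢ y → x ⇾ y ⊎ y ⇾ x
  ⇾-total {x} {y} x≢y with adj T x y in xy
  ... | true  = inj₁ refl
  ... | false = inj₂ (trans (tourn T y x (≢-sym x≢y)) (cong not xy))

  Δ122-copy : ∀ {x y₁ y₂ z₁ z₂} → y₁ ⇾ y₂ → z₁ ⇾ z₂ → x ⇾ y₁ → x ⇾ y₂ →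
    y₁ ⇾ z₁ → y₁ ⇾ z₂ → y₂ ⇾ z₁ → y₂ ⇾ z₂ → z₁ ⇾ x → z₂ ⇾ x → InducedCopy T Δ122
  Δ122-copy {x} {y₁} {y₂} {z₁} {z₂} yy zz xy₁ xy₂ y₁z₁ y₁z₂ y₂z₁ y₂z₂ z₁x z₂x = f , injective , copy
    where
    f : Fin 5 → Fin n
    f 0F = x
    f 1F = y₁
    f 2F = y₂
    f 3F = z₁
    f 4F = z₂

    copy : ∀ a b → adj T (f a) (f b) ≡ Δ122 a b
    copy 0F 0F = irrefl T x
    copy 0F 1F = xy₁
    copy 0F 2F = xy₂
    copy 0F 3F = rev z₁x
    copy 0F 4F = rev z₂x
    copy 1F 0F = rev xy₁
    copy 1F 1F = irrefl T y₁
    copy 1F 2F = yy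
    copy 1F 3F = y₁z₁
    copy 1F 4F = y₁z₂
    copy 2F 0F = rev xy₂
    copy 2F 1F = rev yy
    copy 2F 2F = irrefl T y₂
    copy 2F 3F = y₂z₁
    copy 2F 4F = y₂z₂
    copy 3F 0F = z₁x
    copy 3F 1F = rev y₁z₁
    copy 3F 2F = rev y₂z₁
    copy 3F 3F = irrefl T z₁
    copy 3F 4F = zz
    copy 4F 0F = z₂x
    copy 4F 1F = rev y₁z₂
    copy 4F 2F = rev y₂z₂
    copy 4F 3F = rev zz
    copy 4F 4F = irrefl T z₂

    -- Used for injectivity of `f`: distinct pattern vertices are joined by an edge, which equal
    -- images would turn into a loop. The finitely many pairs are checked by evaluation.
    Δ122-connected : ∀ a b → a ≡ b ⊎ Δ122 a b ≡ true ⊎ Δ122 b a ≡ true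
    Δ122-connected = toWitness {a? = Fin.all? λ a → Fin.all? λ b →
      (a Fin.≟ b) ⊎-dec ((Δ122 a b ≟ᵇ true) ⊎-dec (Δ122 b a ≟ᵇ true))} _

    injective : ∀ {a b} → f a ≡ f b → a ≡ b
    injective {a} {b} fa≡fb with Δ122-connected a b
    ... | inj₁ a≡b       = a≡b
    ... | inj₂ (inj₁ ab) =
      ⊥-elim (⇾-irrefl (subst (_⇾ f b) fa≡fb (trans (copy a b) ab)))
    ... | inj₂ (inj₂ ba) =
      ⊥-elim (⇾-irrefl (subst (f b ⇾_) fa≡fb (trans (copy b a) ba)))

  -- The pattern prescribes the edge inside each pair; swapping names within the pairs brings all
  -- four orientations to that form.
  ¬Δ122 : Δ122-free T → ∀ {x y y′ z z′} → y ≢ y′ → z ≢ z′ → x ⇾ y → x ⇾ y′ →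
    y ⇾ z → y ⇾ z′ → y′ ⇾ z → y′ ⇾ z′ → z ⇾ x → z′ ⇾ x → ⊥
  ¬Δ122 free y≢y′ z≢z′ xy xy′ yz yz′ y′z y′z′ zx z′x with ⇾-total y≢y′ | ⇾-total z≢z′
  ... | inj₁ yy | inj₁ zz = free (Δ122-copy yy zz xy xy′ yz yz′ y′z y′z′ zx z′x)
  ... | inj₁ yy | inj₂ zz = free (Δ122-copy yy zz xy xy′ yz′ yz y′z′ y′z z′x zx)
  ... | inj₂ yy | inj₁ zz = free (Δ122-copy yy zz xy′ xy y′z y′z′ yz yz′ zx z′x)
  ... | inj₂ yy | inj₂ zz = free (Δ122-copy yy zz xy′ xy y′z′ y′z yz′ yz z′x zx)

  lookup-ordered : ∀ {Y} → AllPairs _⇾_ Y → ∀ i j →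
    i ≡ j ⊎ (toℕ i < toℕ j × lookup Y i ⇾ lookup Y j) ⊎ (toℕ j < toℕ i × lookup Y j ⇾ lookup Y i)
  lookup-ordered (_ ∷ _)  zero    zero    = inj₁ refl
  lookup-ordered (p ∷ _)  zero    (suc j) = inj₂ (inj₁ (s≤s z≤n , All.lookup p (∈-lookup j)))
  lookup-ordered (p ∷ _)  (suc i) zero    = inj₂ (inj₂ (s≤s z≤n , All.lookup p (∈-lookup i)))
  lookup-ordered (_ ∷ ps) (suc i) (suc j) with lookup-ordered ps i j
  ... | inj₁ i≡j             = inj₁ (cong suc i≡j)
  ... | inj₂ (inj₁ (lt , e)) = inj₂ (inj₁ (s≤s lt , e))
  ... | inj₂ (inj₂ (gt , e)) = inj₂ (inj₂ (s≤s gt , e))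

  -- Edges between entries point forward in the list, so transitivity is inherited from the order of
  -- positions.
  AllPairs⇒HasTransitiveSub : ∀ {Y} → AllPairs _⇾_ Y → HasTransitiveSub T (length Y)
  AllPairs⇒HasTransitiveSub {Y} Y-trans = lookup Y , injective , transitive
    where
    increasing : ∀ {i j} → lookup Y i ⇾ lookup Y j → toℕ i < toℕ j
    increasing {i} {j} e with lookup-ordered Y-trans i j
    ... | inj₁ refl            = ⊥-elim (⇾-irrefl e)
    ... | inj₂ (inj₁ (lt , _)) = lt
    ... | inj₂ (inj₂ (_ , e′)) = ⊥-elim (⇾-asym e e′)

    injective : ∀ {i j} → lookup Y i ≡ lookup Y j → i ≡ j
    injective {i} {j} eq with lookup-ordered Y-trans i j
    ... | inj₁ i≡j            = i≡j
    ... | inj₂ (inj₁ (_ , e)) = ⊥-elim (⇾-irrefl (subst (_⇾ lookup Y j) eq e))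
    ... | inj₂ (inj₂ (_ , e)) = ⊥-elim (⇾-irrefl (subst (lookup Y j ⇾_) eq e))

    transitive : ∀ a b c → lookup Y a ⇾ lookup Y b → lookup Y b ⇾ lookup Y c →
      lookup Y a ⇾ lookup Y c
    transitive a b c ab bc with <-trans (increasing ab) (increasing bc) | lookup-ordered Y-trans a c
    ... | lt | inj₁ refl            = ⊥-elim (<-irrefl refl lt)
    ... | lt | inj₂ (inj₁ (_ , e))  = e
    ... | lt | inj₂ (inj₂ (gt , _)) = ⊥-elim (<-asym lt gt)

theorem1p4 : (n : ℕ) (T : Tournament n) → Δ122-free T →
    ∃[ k ] (3 * n ≤ 7 * k × HasTransitiveSub T k)
theorem1p4 n T free = unweighted (large-transitive n (allFin n) (const false)
  (≤-reflexive (length-tabulate _)) (allFin⁺ n)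
  -- Initially no vertex is heavy: blowability is vacuous, and size and weight both count vertices.
  (record { triangle-light = λ _ _ _ () ; out-unique = λ _ _ _ _ () ; in-unique = λ _ _ _ _ () }))
  where
  open ΔFree Fin._≟_ (_⇾_ T) (λ x y → adj T x y ≟ᵇ true) (⇾-asym T) (⇾-total T) (¬Δ122 T free)
  open ≤-Reasoning
  unweighted : LargeTransitive (allFin n) (const false) →
    ∃[ k ] (3 * n ≤ 7 * k × HasTransitiveSub T k)
  unweighted (Y , Y-trans , _ , bound) = length Y , size≤ , AllPairs⇒HasTransitiveSub T Y-trans
    where
    size≤ : 3 * n ≤ 7 * length Y
    size≤ = begin
      3 * n                                    ≡⟨ cong (3 *_) (length-tabulate {n = n} (λ i → i)) ⟨
      3 * length (allFin n)                    ≡⟨ cong (3 *_) (sum-map-1 (allFin n)) ⟨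
      3 * total-size (const false) (allFin n)  ≤⟨ bound ⟩
      7 * total-weight (const false) Y         ≡⟨ cong (7 *_) (sum-map-1 Y) ⟩
      7 * length Y                             ∎
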